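{- Let $n,k$ be positive integers with $n\ge 2k+1$. If $3\binom{n-k}{k} \ge 2\binom{n}{k}$ and $k \ge 2$, then $tw(BK(n,k)) = \binom{n}{k} - 1$.
   Context: The bipartite Kneser graph $BK(n,k)$ is the bipartite graph whose two parts are the family of all $k$-subsets of $[n]=\{1,\dots,n\}$ and the family of all $(n-k)$-subsets of $[n]$, a $k$-subset $A$ and an $(n-k)$-subset $B$ being adjacent iff $A\subseteq B$. $tw(G)$ denotes treewidth. -}

module Defs where

open import Data.Empty using (⊥)
open import Data.Fin.Base using (Fin)
open import Data.Fin.Subset using (Subset; ∣_∣; _⊆_)
open import Data.Fin.Subset.Properties using (_⊆?_)
open import Data.List.Base using (List; []; _∷_; _++_; [_]; length)
open import Data.List.Membership.Propositional using (_∈_)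
open import Data.List.Relation.Unary.Linked using (Linked)
open import Data.List.Relation.Unary.Unique.Propositional using (Unique)
open import Data.Nat.Base using (ℕ; suc; _∸_; _⊔_; _≤_)
open import Data.Product.Base using (Σ; ∃; _×_; proj₁)
open import Data.Sum.Base using (_⊎_; inj₁; inj₂)
import Data.Vec.Functional as Vector
open import Relation.Binary.Construct.Closure.ReflexiveTransitive using (Star)
open import Relation.Binary.Core using (Rel)
open import Relation.Binary.Definitions using (Decidable; Irreflexive; Symmetric)
open import Relation.Binary.PropositionalEquality.Core using (_≡_; _≢_; refl)
open import Relation.Nullary.Decidable.Core using (no)
open import Relation.Nullary.Negation.Core using (¬_)
open import Level using (0ℓ)

-- Decidability of adjacency is automatic classically; it only makes the
-- combinatorics of finite graphs available constructively.
record SimpleGraph (V : Set) : Set₁ where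
  field
    Adj     : Rel V 0ℓ
    adj?    : Decidable Adj
    symm    : Symmetric Adj
    irrefl  : Irreflexive _≡_ Adj

module _ {V : Set} (G : SimpleGraph V) where
  open SimpleGraph G

  -- Connectedness of the subgraph of G induced by the vertices satisfying P
  -- (vacuously true if there are none).
  InducedConnected : (V → Set) → Set
  InducedConnected P =
    ∀ {u v} → P u → P v → Star (λ x y → Adj x y × P x × P y) u v

  Connected : Set
  Connected = ∀ u v → Star Adj u v

  -- A cycle x , vs , y has pairwise distinct vertices, and at least three of
  -- them since vs is non-empty; the closing edge is y x.
  record Cycle : Set where
    field
      x y      : V
      vs       : List V
      nonempty : vs ≢ []
      distinct : Unique (x ∷ vs ++ [ y ])
      path     : Linked Adj (x ∷ vs ++ [ y ])
      closing  : Adj y x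

  IsTree : Set
  IsTree = Connected × ¬ Cycle

-- The nodes of the tree are Fin (suc order), so a tree is finite and non-empty.
-- Bags are finite sets of vertices, represented by duplicate-free lists, so
-- that the cardinality of a bag is its length.
record TreeDecomposition {V : Set} (G : SimpleGraph V) : Set₁ where
  open SimpleGraph G
  field
    order : ℕ

  Node : Set
  Node = Fin (suc order)

  field
    tree        : SimpleGraph Node
    isTree      : IsTree tree
    bag         : Node → List V
    bagUnique   : ∀ t → Unique (bag t)
    coversVert  : ∀ v → ∃ λ t → v ∈ bag t
    coversEdge  : ∀ {u v} → Adj u v → ∃ λ t → u ∈ bag t × v ∈ bag t
    connected   : ∀ v → InducedConnected tree (λ t → v ∈ bag t)

  -- Truncated subtraction agrees with subtraction as soon as G has a vertex.
  width : ℕ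
  width = Vector.foldr _⊔_ 0 (λ t → length (bag t)) ∸ 1

-- tw(G) = w: w is the minimum width of a tree decomposition of G.
IsTreewidth : {V : Set} → SimpleGraph V → ℕ → Set₁
IsTreewidth G w =
    (Σ (TreeDecomposition G) λ D → TreeDecomposition.width D ≡ w)
  × (∀ (D : TreeDecomposition G) → w ≤ TreeDecomposition.width D)

SubsetOfSize : ℕ → ℕ → Set
SubsetOfSize n k = Σ (Subset n) λ A → ∣ A ∣ ≡ k

-- The two parts are kept apart by tagging; they are genuinely disjoint families
-- of subsets when n ≢ 2 k.
BKVertex : ℕ → ℕ → Set
BKVertex n k = SubsetOfSize n k ⊎ SubsetOfSize n (n ∸ k)

BKAdj : ∀ n k → Rel (BKVertex n k) 0ℓ
BKAdj n k (inj₁ A) (inj₂ B) = proj₁ A ⊆ proj₁ B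
BKAdj n k (inj₂ B) (inj₁ A) = proj₁ A ⊆ proj₁ B
BKAdj n k (inj₁ _) (inj₁ _) = ⊥
BKAdj n k (inj₂ _) (inj₂ _) = ⊥

BK : ∀ n k → SimpleGraph (BKVertex n k)
BK n k = record
  { Adj    = BKAdj n k
  ; adj?   = dec
  ; symm   = λ {u} {v} → sym′ u v
  ; irrefl = λ {u} → irr u
  }
  where
  dec : Decidable (BKAdj n k)
  dec (inj₁ A) (inj₂ B) = proj₁ A ⊆? proj₁ B
  dec (inj₂ B) (inj₁ A) = proj₁ A ⊆? proj₁ B
  dec (inj₁ _) (inj₁ _) = no λ ()
  dec (inj₂ _) (inj₂ _) = no λ ()

  sym′ : ∀ u v → BKAdj n k u v → BKAdj n k v u
  sym′ (inj₁ _) (inj₂ _) A⊆B = A⊆B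
  sym′ (inj₂ _) (inj₁ _) A⊆B = A⊆B

  irr : ∀ u {v} → u ≡ v → ¬ BKAdj n k u v
  irr (inj₁ _) refl ()
  irr (inj₂ _) refl ()

{-# OPTIONS --safe #-}
module Submission where

-- Write N = C(n,k) and d = C(n-k,k): both parts have N vertices and every
-- vertex has degree d.  For the upper bound, take a star whose centre bag is
-- the part of k-subsets, with one leaf bag {B} ∪ N(B) for each B in the other
-- part.
--
-- The lower bound uses only 3d ≥ 2N.  Suppose all bags X_t have fewer than N
-- vertices.  Call X confining for an edge uv if N(x) ⊆ X for every x ∉ X in
-- N(u) ∪ N(v).  A confining X has at least N elements.  Indeed, if more than
-- N - d neighbours of u lie outside X, every vertex in the part of u is
-- adjacent to one of them, so that part is contained in X.  Otherwise X
-- contains at least 2d - N vertices of the part of v, and also d vertices of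
-- one part: of the part of v if N(u) ⊆ X, and of the part of u (namely N(w))
-- if some w ∈ N(u) is outside X.  The same holds for v, so |X| ≥ 3d - N ≥ N.
-- Hence no bag is confining.  So when a walk in the tree has just gone from t
-- to s because an edge uv avoiding X_t lies on the side of s, there is also an
-- edge xy avoiding X_s that lies beyond s, away from t, and the walk can
-- continue there.  It never turns back, which is impossible in a finite tree.

open import Defs
open import Data.Nat.Base using (ℕ; _+_; _*_; _∸_; _≤_; _≥_)
open import Data.Nat.Combinatorics using (_C_)
open import Data.Bool.Base using (true; false)
import Data.Bool.Properties as Bool
open import Data.Empty using (⊥; ⊥-elim)
open import Data.Fin.Base using (Fin; zero; suc)
import Data.Fin.Properties as Fin
open import Data.Fin.Subset as Subset using (Subset; ∁; inside; outside)
import Data.Fin.Subset.Properties as Subset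
open import Data.List.Base using (List; []; _∷_; _++_; [_]; length; lookup; map; filter)
open import Data.List.Membership.Propositional using (_∈_; _∉_; find; lose)
open import Data.List.Membership.Propositional.Properties
  using (∈-lookup; ∈-map⁺; ∈-map⁻; ∈-filter⁺; ∈-filter⁻; ∈-++⁻; ∈-++⁺ˡ; ∈-++⁺ʳ)
open import Data.List.Properties using (length-map; length-++; filter-notAll)
open import Data.List.Relation.Binary.Subset.Propositional using (_⊆_)
open import Data.List.Relation.Unary.All as All using (All; []; _∷_)
import Data.List.Relation.Unary.All.Properties as All
open import Data.List.Relation.Unary.AllPairs using ([]; _∷_)
open import Data.List.Relation.Unary.Any as Any using (here; there)
open import Data.List.Relation.Unary.Any.Properties using (lookup-index)
open import Data.List.Relation.Unary.Linked using (Linked; [-]; _∷_)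
open import Data.List.Relation.Unary.Unique.Propositional using (Unique)
import Data.List.Relation.Unary.Unique.Propositional.Properties as Unique
open import Data.Nat.Base using (zero; suc; _<_; _⊔_; z≤n; s≤s)
open import Data.Nat.Combinatorics using (nCk≡nC[n∸k]; nCk+nC[k+1]≡[n+1]C[k+1]; nCn≡1)
import Data.Nat.Properties as ℕ
open import Data.Product.Base using (∃; _×_; _,_; proj₁; proj₂)
import Data.Product.Properties as Product
open import Data.Sum.Base as Sum using (_⊎_; inj₁; inj₂)
import Data.Sum.Properties as Sum
open import Data.Unit.Base using (⊤; tt)
open import Data.Vec.Base using ([]; _∷_; here; there)
import Data.Vec.Functional as Vector
import Data.Vec.Properties as Vec
open import Function.Base using (_∘_; id)
open import Level using (0ℓ)
open import Relation.Binary.Construct.Closure.ReflexiveTransitive as Star using (Star; ε; _◅_; _◅◅_)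
open import Relation.Binary.Definitions using (DecidableEquality)
open import Relation.Binary.PropositionalEquality
  using (_≡_; _≢_; refl; sym; trans; cong; cong₂; subst; ≢-sym; module ≡-Reasoning)
open import Relation.Nullary using (¬_; Dec; yes; no; does; contradiction; decidable-stable)
open import Relation.Nullary.Decidable using (¬?)
open import Relation.Unary using (Pred; Decidable)

-- Counting with duplicate-free lists, and finite maxima.

lookup-injective : ∀ {A : Set} {xs : List A} → Unique xs →
  ∀ {i j} → lookup xs i ≡ lookup xs j → i ≡ j
lookup-injective (x∉ ∷ u) {zero}  {zero}  eq = refl
lookup-injective (x∉ ∷ u) {zero}  {suc j} eq = contradiction eq (All.lookup x∉ (∈-lookup j))
lookup-injective (x∉ ∷ u) {suc i} {zero}  eq = contradiction (sym eq) (All.lookup x∉ (∈-lookup i))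
lookup-injective (x∉ ∷ u) {suc i} {suc j} eq = cong suc (lookup-injective u eq)

-- Pigeonhole: sending each position of `xs` to a position of the same element in `ys` is injective,
-- because `xs` has no repetitions.
length-mono-⊆ : ∀ {A : Set} {xs ys : List A} → Unique xs → xs ⊆ ys → length xs ≤ length ys
length-mono-⊆ {xs = xs} {ys} u xs⊆ys =
  Fin.injective⇒≤ {f = λ i → Any.index (xs⊆ys (∈-lookup i))} λ {i} {j} eq →
    lookup-injective u (trans (lookup-index (xs⊆ys (∈-lookup i)))
      (trans (cong (lookup ys) eq) (sym (lookup-index (xs⊆ys (∈-lookup j))))))

length-filter-∁ : ∀ {A : Set} {P : Pred A 0ℓ} (P? : Decidable P) xs →
  length (filter P? xs) + length (filter (¬? ∘ P?) xs) ≡ length xs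
length-filter-∁ P? []       = refl
length-filter-∁ P? (x ∷ xs) with does (P? x)
... | true  = cong suc (length-filter-∁ P? xs)
... | false = trans (ℕ.+-suc _ _) (cong suc (length-filter-∁ P? xs))

foldr-⊔-≤ : ∀ {m w} (f : Fin m → ℕ) → (∀ i → f i ≤ w) → Vector.foldr _⊔_ 0 f ≤ w
foldr-⊔-≤ {zero}  f f≤w = z≤n
foldr-⊔-≤ {suc m} f f≤w = ℕ.⊔-lub (f≤w zero) (foldr-⊔-≤ (f ∘ suc) (f≤w ∘ suc))

≤-foldr-⊔ : ∀ {m} (f : Fin m → ℕ) i → f i ≤ Vector.foldr _⊔_ 0 f
≤-foldr-⊔ f zero    = ℕ.m≤m⊔n (f zero) _
≤-foldr-⊔ f (suc i) = ℕ.≤-trans (≤-foldr-⊔ (f ∘ suc) i) (ℕ.m≤n⊔m (f zero) _)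

member : ∀ {A : Set} (xs : List A) → 0 < length xs → ∃ (_∈ xs)
member (x ∷ _) _ = x , here refl

-- Simple paths, and the two sides of a tree edge.

module Paths {V : Set} (G : SimpleGraph V) (_≟_ : DecidableEquality V) where
  open SimpleGraph G
  open import Data.List.Membership.DecPropositional _≟_ using (_∈?_)

  data Path : V → V → List V → Set where
    stop : ∀ {a} → Path a a [ a ]
    step : ∀ {a b c l} → Adj a b → a ∉ l → Path b c l → Path a c (a ∷ l)

  start-∈ : ∀ {a b l} → Path a b l → a ∈ l
  start-∈ stop         = here refl
  start-∈ (step _ _ _) = here refl

  suffix : ∀ {a b x l} → Path a b l → x ∈ l → ∃ λ l′ → Path x b l′ × l′ ⊆ l
  suffix stop           (here refl) = _ , stop , id
  suffix (step e a∉ p)  (here refl) = _ , step e a∉ p , id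
  suffix (step e a∉ p)  (there x∈)  with suffix p x∈
  ... | _ , q , l′⊆l = _ , q , there ∘ l′⊆l

  prefix : ∀ {a b x l} → Path a b l → x ∈ l → ∃ λ l′ → Path a x l′ × l′ ⊆ l
  prefix stop           (here refl) = _ , stop , id
  prefix (step e a∉ p)  (here refl) = _ , stop , λ { (here refl) → here refl }
  prefix (step e a∉ p)  (there x∈)  with prefix p x∈
  ... | _ , q , l′⊆l = _ , step e (a∉ ∘ l′⊆l) q ,
    λ { (here refl) → here refl ; (there y∈) → there (l′⊆l y∈) }

  path-unique : ∀ {a b l} → Path a b l → Unique l
  path-unique stop          = [] ∷ []
  path-unique (step _ a∉ p) = All.¬Any⇒All¬ _ a∉ ∷ path-unique p

  path-linked : ∀ {a b l} → Path a b l → Linked Adj l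
  path-linked stop                        = [-]
  path-linked (step e _ stop)             = e ∷ [-]
  path-linked (step e _ p@(step _ _ _))   = e ∷ path-linked p

  path-∷ʳ : ∀ {a b l} → Path a b l → ∃ λ vs → l ≡ vs ++ [ b ]
  path-∷ʳ stop               = [] , refl
  path-∷ʳ (step {a} _ _ p) with path-∷ʳ p
  ... | vs , refl = a ∷ vs , refl

  -- Loop erasure: if `a` recurs on the path built for the rest of the walk, only the suffix from
  -- that occurrence is kept. The walk imposes `Q` on the targets of its steps only, hence the
  -- separate `Q a`.
  Star⇒Path : ∀ {Q : Pred V 0ℓ} {a b} → Q a → Star (λ x y → Adj x y × Q y) a b →
    ∃ λ l → Path a b l × All Q l
  Star⇒Path qa ε = _ , stop , qa ∷ []
  Star⇒Path {a = a} qa ((e , qc) ◅ w) with Star⇒Path qc w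
  ... | l , p , ql with a ∈? l
  ...   | no  a∉ = _ , step e a∉ p , qa ∷ ql
  ...   | yes a∈ with suffix p a∈
  ...     | _ , p′ , l′⊆l = _ , p′ , All.anti-mono l′⊆l ql

  Path⇒Star : ∀ {Q : Pred V 0ℓ} {a b l} → Path a b l → All Q l → Star (λ x y → Adj x y × Q y) a b
  Path⇒Star stop _ = ε
  Path⇒Star (step e _ p) (_ ∷ ql) = (e , All.lookup ql (start-∈ p)) ◅ Path⇒Star p ql

  -- With three or more vertices, the path and the edge from `b` back to `a` would form a cycle;
  -- with one vertex, the edge would be a loop.
  chord : ¬ Cycle G → ∀ {a b l} → Path a b l → Adj b a → l ≡ a ∷ b ∷ []
  chord acyclic stop                  e = ⊥-elim (irrefl refl e)
  chord acyclic (step _ _ stop)       e = refl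
  chord acyclic {a} {b} p@(step {b = c} _ _ (step _ _ q)) e with path-∷ʳ q
  ... | vs , refl = ⊥-elim (acyclic record
    { x = a ; y = b ; vs = c ∷ vs ; nonempty = λ ()
    ; distinct = path-unique p ; path = path-linked p ; closing = e })

  -- For an edge t s of a tree, the nodes r with Side t s r are those on the
  -- far side of s when the edge is deleted.
  Side : V → V → V → Set
  Side t s = Star (λ x y → Adj x y × y ≢ t) s

  Side⇒≢ : ∀ {t s r} → s ≢ t → Side t s r → r ≢ t
  Side⇒≢ s≢t ε             = s≢t
  Side⇒≢ _ ((_ , y≢t) ◅ w) = Side⇒≢ y≢t w

  module _ (acyclic : ¬ Cycle G) where

    -- Since the walk from `s` to `r` avoids `t`, its loop erasure preceded by `t` is a simple path
    -- from `t` to `r`. The edge `e′` closes it, so by `chord` it is a single edge.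
    crossing : ∀ {t s r} → Adj t s → Side t s r → Adj r t → r ≡ s
    crossing e w e′ with Star⇒Path (λ { refl → irrefl refl e }) w
    ... | _ , p , l≢t with chord acyclic (step e (λ t∈ → All.lookup l≢t t∈ refl) p) e′
    ...   | refl with p
    ...     | stop = refl

    first-step : ∀ {a b l} → Path a b l → b ≢ a → ∃ λ c → Adj a c × c ∈ l × Side a c b
    first-step stop b≢a = contradiction refl b≢a
    first-step (step e a∉ p) _ = _ , e , there (start-∈ p) ,
      Path⇒Star p (All.map ≢-sym (All.¬Any⇒All¬ _ a∉))

-- Walking through a tree decomposition without confining bags.

module _ {V : Set} {G : SimpleGraph V} (_≟_ : DecidableEquality V) where
  open SimpleGraph G
  open import Data.List.Membership.DecPropositional _≟_ using (_∈?_)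

  -- What is used is its failure: classically, some edge `x y` then misses `X`, with `x` a neighbour
  -- of `u` or `v`.
  Confined : List V → V → V → Set
  Confined X u v = ∀ {x y} → Adj u x ⊎ Adj v x → x ∉ X → Adj x y → y ∈ X

  module _ (D : TreeDecomposition G) where
    open TreeDecomposition D
    open Paths tree Fin._≟_
    private module T = SimpleGraph tree

    acyclic : ¬ Cycle tree
    acyclic = proj₂ isTree

    adj⇒≢ : ∀ {t s} → T.Adj t s → s ≢ t
    adj⇒≢ e refl = T.irrefl refl e

    -- Follow a walk from `r` to `r′` through bags containing `x`. It stays on the side of `s` until
    -- it first reaches `t`; by `crossing` it arrives there from `s`, so both bags contain `x`.
    side-or-separator : ∀ {t s r r′ x} → T.Adj t s → Side t s r → x ∈ bag r → x ∈ bag r′ →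
      Side t s r′ ⊎ (x ∈ bag s × x ∈ bag t)
    side-or-separator {t} {s} {x = x} e w x∈r x∈r′ = go w (connected x x∈r x∈r′)
      where
      go : ∀ {r r′} → Side t s r → Star (λ a b → T.Adj a b × x ∈ bag a × x ∈ bag b) r r′ →
        Side t s r′ ⊎ (x ∈ bag s × x ∈ bag t)
      go w ε = inj₁ w
      go w (_◅_ {j = q} (e′ , x∈r , x∈q) p) with q Fin.≟ t
      ... | no  q≢t  = go (w ◅◅ ((e′ , q≢t) ◅ ε)) p
      ... | yes refl = inj₂ (subst (λ r → x ∈ bag r) (crossing acyclic e w e′) x∈r , x∈q)

    module _ {t s} (e : T.Adj t s) where

      OnSide : V → Set
      OnSide x = ∃ λ r → Side t s r × x ∈ bag r

      edge-on-side : ∀ {x y} → OnSide x → x ∉ bag t → Adj x y →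
        ∃ λ r → Side t s r × x ∈ bag r × y ∈ bag r
      edge-on-side (r , w , x∈r) x∉t xy with coversEdge xy
      ... | r′ , x∈r′ , y∈r′ with side-or-separator e w x∈r x∈r′
      ...   | inj₁ w′        = r′ , w′ , x∈r′ , y∈r′
      ...   | inj₂ (_ , x∈t) = contradiction x∈t x∉t

      -- As `t` is not on the side of `s`, a vertex of `bag t` that also occurs on that side must
      -- lie in `bag s`.
      ∉-back : ∀ {x} → OnSide x → x ∉ bag s → x ∉ bag t
      ∉-back (r , w , x∈r) x∉s x∈t with side-or-separator e w x∈r x∈t
      ... | inj₁ w′        = Side⇒≢ (adj⇒≢ e) w′ refl
      ... | inj₂ (x∈s , _) = x∉s x∈s

      -- One step of the walk from `s`. The negated universal `¬ Confined` is not turned into a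
      -- witness; the goal is `⊥`, and the new edge is handed to a continuation.
      advance : ∀ {r u v} → ¬ Confined (bag s) u v → Side t s r →
        u ∉ bag t → u ∈ bag r → v ∉ bag t → v ∈ bag r →
        (∀ {s′ r′ x y} → s′ ≢ t → T.Adj s s′ → Side s s′ r′ → Adj x y →
          x ∉ bag s → x ∈ bag r′ → y ∉ bag s → y ∈ bag r′ → ⊥) → ⊥
      advance {r} {u} {v} ¬confined w u∉ u∈ v∉ v∈ continue =
        ¬confined λ {x} {y} nbr x∉ xy → decidable-stable (y ∈? bag s) λ y∉ →
          -- The edge `x y` misses `bag s`, and `x` also misses `bag t`, so a bag `r′` containing
          -- the edge lies on the side of `s`. A path from `s` to `r′` avoids `t` and is nontrivial;
          -- its first step gives `s′`.
          let x-side = on-side nbr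
              r′ , w′ , x∈ , y∈ = edge-on-side x-side (∉-back x-side x∉) xy
              l , p , l≢t = Star⇒Path (adj⇒≢ e) w′
              s′ , e′ , s′∈l , w″ = first-step acyclic p λ r≡s → x∉ (subst (λ q → x ∈ bag q) r≡s x∈)
          in continue (All.lookup l≢t s′∈l) e′ w″ xy x∉ x∈ y∉ y∈
        where
        on-side : ∀ {x} → Adj u x ⊎ Adj v x → OnSide x
        on-side (inj₁ ux) = let r′ , w′ , _ , x∈ = edge-on-side (r , w , u∈) u∉ ux in r′ , w′ , x∈
        on-side (inj₂ vx) = let r′ , w′ , _ , x∈ = edge-on-side (r , w , v∈) v∉ vx in r′ , w′ , x∈

    module _ (unconfined : ∀ t {u v} → Adj u v → ¬ Confined (bag t) u v) where

      -- Here `s` is the current node and `l` the path walked so far, from the previous node `t`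
      -- back to the origin `o`. The nodes of `s ∷ l` are distinct, so there are at most `suc order`
      -- of them; `bound` rules this out once the fuel is gone.
      no-walk : ∀ fuel {t s o l r u v} → suc order ≤ length l + fuel →
        T.Adj s t → s ∉ l → Path t o l → Side t s r → Adj u v →
        u ∉ bag t → u ∈ bag r → v ∉ bag t → v ∈ bag r → ⊥
      no-walk zero {l = l} bound e s∉ p _ _ _ _ _ _ =
        ℕ.<⇒≱ (Fin.injective⇒≤ (lookup-injective (path-unique (step e s∉ p))))
          (subst (suc order ≤_) (ℕ.+-identityʳ (length l)) bound)
      no-walk (suc fuel) {t} {s} {l = l} bound e s∉ p w uv u∉ u∈ v∉ v∈ =
        advance (T.symm e) (unconfined s uv) w u∉ u∈ v∉ v∈
          λ s′≢t e′ → no-walk fuel (subst (suc order ≤_) (ℕ.+-suc (length l) fuel) bound)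
            (T.symm e′) (fresh s′≢t e′) (step e s∉ p)
        where
        -- If `s′` were already on `l`, the path from `s` through `t` to `s′` would be closed by an
        -- edge, forcing `s′ ≡ t`: the walk would turn back.
        fresh : ∀ {s′} → s′ ≢ t → T.Adj s s′ → s′ ∉ s ∷ l
        fresh s′≢t e′ (here refl) = T.irrefl refl e′
        fresh s′≢t e′ (there s′∈) with prefix p s′∈
        ... | l′ , q , l′⊆l with chord acyclic (step e (s∉ ∘ l′⊆l) q) (T.symm e′)
        ...   | refl with q
        ...     | stop = s′≢t refl

      no-unconfined-decomposition : ∀ {u v} → Adj u v → ⊥
      no-unconfined-decomposition uv =
        -- The walk starts at node `zero`: its bag does not confine `uv`, so some edge misses it,
        -- and the first step leads towards a bag containing that edge. The initial path has one
        -- node, which leaves fuel `order`.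
        unconfined zero uv λ {x} {y} _ x∉ xy → decidable-stable (y ∈? bag zero) λ y∉ →
          let r , x∈ , y∈ = coversEdge xy
              l , p , _ = Star⇒Path tt (Star.map (_, tt) (proj₁ isTree zero r))
              s , e , _ , w = first-step acyclic p λ r≡0 → x∉ (subst (λ q → x ∈ bag q) r≡0 x∈)
          in no-walk order ℕ.≤-refl (T.symm e) (λ { (here s≡0) → adj⇒≢ e s≡0 ; (there ()) })
               stop w xy x∉ x∈ y∉ y∈

-- Confining sets have at least N elements.

module _ {V : Set} {G : SimpleGraph V} (_≟_ : DecidableEquality V) where
  open SimpleGraph G
  open import Data.List.Membership.DecPropositional _≟_ using (_∈?_)

  module _ {N d : ℕ} (2N≤3d : 2 * N ≤ 3 * d) (nb : V → List V)
    (nb-unique : ∀ x → Unique (nb x)) (nb-adj : ∀ x → All (Adj x) (nb x))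
    (d≤nb : ∀ x → d ≤ length (nb x)) (X : List V) where

    private
      #X : List V → ℕ
      #X = length ∘ filter (_∈? X)

    -- The dichotomy seen from one end `u` of the edge, by whether more than N - d of the listed
    -- neighbours of `u` miss `X`. The parts `ps` and `qs` are parameters so that it applies to both
    -- ends.
    missed-or-dense : ∀ {ps qs u} → Unique ps → length ps ≡ N → length qs ≡ N →
      (∀ {x} → x ∈ ps → nb x ⊆ qs) → (∀ {x} → x ∈ qs → nb x ⊆ ps) → u ∈ ps →
      (∀ {x y} → Adj u x → x ∉ X → Adj x y → y ∈ X) →
      N ≤ #X ps ⊎ (2 * d ≤ #X qs + N × (d ≤ #X ps ⊎ d ≤ #X qs))
    missed-or-dense {ps} {qs} {u} ps! ∣ps∣ ∣qs∣ nb-ps nb-qs u∈ confined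
      = by-size (N ℕ.<? length missed + d)
      where
      hit missed : List V
      hit    = filter (_∈? X) (nb u)
      missed = filter (¬? ∘ (_∈? X)) (nb u)

      missed! : Unique missed
      missed! = Unique.filter⁺ _ (nb-unique u)

      missed⊆nb : missed ⊆ nb u
      missed⊆nb = proj₁ ∘ ∈-filter⁻ (¬? ∘ (_∈? X))

      through-missed : ∀ {w y} → w ∈ missed → Adj w y → y ∈ X
      through-missed w∈ = confined (All.lookup (nb-adj u) (missed⊆nb w∈))
        (proj₂ (∈-filter⁻ (¬? ∘ (_∈? X)) {xs = nb u} w∈))

      hit≤ : length hit ≤ #X qs
      hit≤ = length-mono-⊆ (Unique.filter⁺ _ (nb-unique u)) λ w∈ →
        let w∈nb , w∈X = ∈-filter⁻ (_∈? X) w∈ in ∈-filter⁺ (_∈? X) (nb-ps u∈ w∈nb) w∈X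

      d≤hit+missed : d ≤ length hit + length missed
      d≤hit+missed = ℕ.≤-trans (d≤nb u) (ℕ.≤-reflexive (sym (length-filter-∁ (_∈? X) (nb u))))

      -- Inside `qs`, which has N elements, `missed` and `nb p` are too large to be disjoint. A
      -- common element lies outside `X` and is adjacent to `p`, so confinement puts `p` in `X`.
      ps⊆X : N < length missed + d → ps ⊆ X
      ps⊆X N< {p} p∈ with Any.any? (_∈? nb p) missed
      ... | yes common = let w , w∈ , w∈nb = find common in
        through-missed w∈ (symm (All.lookup (nb-adj p) w∈nb))
      ... | no  disjoint = contradiction N< (ℕ.≤⇒≯ (begin
        length missed + d             ≤⟨ ℕ.+-monoʳ-≤ (length missed) (d≤nb p) ⟩
        length missed + length (nb p) ≡⟨ length-++ missed ⟨
        length (missed ++ nb p)       ≤⟨ length-mono-⊆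
          (Unique.++⁺ missed! (nb-unique p) λ (w∈ , w∈nb) → disjoint (lose w∈ w∈nb))
          (Sum.[ nb-ps u∈ ∘ missed⊆nb , nb-ps p∈ ] ∘ ∈-++⁻ missed) ⟩
        length qs                     ≡⟨ ∣qs∣ ⟩
        N                             ∎))
        where open ℕ.≤-Reasoning

      -- The list `ws` stands for `missed`, so that it can be split. If it is empty, d neighbours of
      -- `u` are in `X`; otherwise all of `nb w` is, by confinement.
      dense : ∀ ws → ws ⊆ missed → d ≤ length hit + length ws → d ≤ #X ps ⊎ d ≤ #X qs
      dense [] _ d≤ = inj₂ (ℕ.≤-trans d≤ (ℕ.≤-trans (ℕ.≤-reflexive (ℕ.+-identityʳ _)) hit≤))
      dense (w ∷ _) ws⊆ _ = inj₁ (ℕ.≤-trans (d≤nb w) (length-mono-⊆ (nb-unique w) λ y∈ →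
        ∈-filter⁺ (_∈? X) (nb-qs (nb-ps u∈ (missed⊆nb (ws⊆ (here refl)))) y∈)
          (through-missed (ws⊆ (here refl)) (All.lookup (nb-adj w) y∈))))

      by-size : Dec (N < length missed + d) →
        N ≤ #X ps ⊎ (2 * d ≤ #X qs + N × (d ≤ #X ps ⊎ d ≤ #X qs))
      by-size (yes N<) = inj₁ (ℕ.≤-trans (ℕ.≤-reflexive (sym ∣ps∣))
        (length-mono-⊆ ps! λ p∈ → ∈-filter⁺ (_∈? X) p∈ (ps⊆X N< p∈)))
      by-size (no N≮) = inj₂ (2d≤ , dense missed id d≤hit+missed)
        where
        open ℕ.≤-Reasoning
        -- The bound 2d - N on the number of elements of `qs` in `X`, stated without truncated
        -- subtraction.
        2d≤ : 2 * d ≤ #X qs + N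
        2d≤ = begin
          2 * d                                ≡⟨ cong (d +_) (ℕ.+-identityʳ d) ⟩
          d + d                                ≤⟨ ℕ.+-monoˡ-≤ d d≤hit+missed ⟩
          length hit + length missed + d       ≡⟨ ℕ.+-assoc (length hit) _ d ⟩
          length hit + (length missed + d)     ≤⟨ ℕ.+-mono-≤ hit≤ (ℕ.≮⇒≥ N≮) ⟩
          #X qs + N                            ∎

    confined⇒large : ∀ {ps qs u v} → Unique ps → Unique qs → (∀ {x} → x ∈ ps → x ∉ qs) →
      length ps ≡ N → length qs ≡ N →
      (∀ {x} → x ∈ ps → nb x ⊆ qs) → (∀ {x} → x ∈ qs → nb x ⊆ ps) →
      u ∈ ps → v ∈ qs → Confined {G = G} _≟_ X u v → N ≤ length X
    confined⇒large {ps} {qs} ps! qs! ps#qs ∣ps∣ ∣qs∣ nb-ps nb-qs u∈ v∈ confined =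
      combine (missed-or-dense ps! ∣ps∣ ∣qs∣ nb-ps nb-qs u∈ (confined ∘ inj₁))
              (missed-or-dense qs! ∣qs∣ ∣ps∣ nb-qs nb-ps v∈ (confined ∘ inj₂))
      where
      open ℕ.≤-Reasoning

      #X-sum : #X ps + #X qs ≤ length X
      #X-sum = begin
        #X ps + #X qs                                    ≡⟨ length-++ (filter (_∈? X) ps) ⟨
        length (filter (_∈? X) ps ++ filter (_∈? X) qs)  ≤⟨ length-mono-⊆
          (Unique.++⁺ (Unique.filter⁺ _ ps!) (Unique.filter⁺ _ qs!) λ (x∈ , x∈′) →
            ps#qs (proj₁ (∈-filter⁻ (_∈? X) x∈)) (proj₁ (∈-filter⁻ (_∈? X) x∈′)))
          (Sum.[ proj₂ ∘ ∈-filter⁻ (_∈? X) {xs = ps} , proj₂ ∘ ∈-filter⁻ (_∈? X) {xs = qs} ]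
            ∘ ∈-++⁻ (filter (_∈? X) ps)) ⟩
        length X                                         ∎

      count : ∀ {a b} → d ≤ a → 2 * d ≤ b + N → a + b ≤ length X → N ≤ length X
      count {a} {b} d≤a 2d≤ a+b≤ = ℕ.+-cancelʳ-≤ N N (length X) (begin
        N + N         ≡⟨ cong (N +_) (ℕ.+-identityʳ N) ⟨
        2 * N         ≤⟨ 2N≤3d ⟩
        d + 2 * d     ≤⟨ ℕ.+-mono-≤ d≤a 2d≤ ⟩
        a + (b + N)   ≡⟨ ℕ.+-assoc a b N ⟨
        a + b + N     ≤⟨ ℕ.+-monoˡ-≤ N a+b≤ ⟩
        length X + N  ∎)

      combine : N ≤ #X ps ⊎ (2 * d ≤ #X qs + N × (d ≤ #X ps ⊎ d ≤ #X qs)) →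
        N ≤ #X qs ⊎ (2 * d ≤ #X ps + N × (d ≤ #X qs ⊎ d ≤ #X ps)) → N ≤ length X
      combine (inj₁ N≤) _         = ℕ.≤-trans N≤ (ℕ.≤-trans (ℕ.m≤m+n _ _) #X-sum)
      combine (inj₂ _)  (inj₁ N≤) = ℕ.≤-trans N≤ (ℕ.≤-trans (ℕ.m≤n+m _ _) #X-sum)
      -- The bounds d and 2d - N must concern different parts to be added. If the end `u` gives both
      -- for `qs`, the end `v` supplies 2d - N for `ps`.
      combine (inj₂ (2d≤q , inj₁ d≤p)) _ = count d≤p 2d≤q #X-sum
      combine (inj₂ (_ , inj₂ d≤q)) (inj₂ (2d≤p , _)) =
        count d≤q 2d≤p (ℕ.≤-trans (ℕ.≤-reflexive (ℕ.+-comm (#X qs) (#X ps))) #X-sum)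

-- Upper bound: the star-shaped decomposition of a bipartite graph.

star : ∀ m → SimpleGraph (Fin (suc m))
star m = record
  { Adj = Adj★ ; adj? = adj★? ; symm = λ {s} {t} → sym★ s t ; irrefl = λ {s} → irr★ s }
  where
  Adj★ : Fin (suc m) → Fin (suc m) → Set
  Adj★ zero    (suc _) = ⊤
  Adj★ (suc _) zero    = ⊤
  Adj★ _       _       = ⊥

  adj★? : ∀ s t → Dec (Adj★ s t)
  adj★? zero    zero    = no λ ()
  adj★? zero    (suc _) = yes tt
  adj★? (suc _) zero    = yes tt
  adj★? (suc _) (suc _) = no λ ()

  sym★ : ∀ s t → Adj★ s t → Adj★ t s
  sym★ zero    (suc _) _ = tt
  sym★ (suc _) zero    _ = tt

  irr★ : ∀ s {t} → s ≡ t → ¬ Adj★ s t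
  irr★ zero    refl ()
  irr★ (suc _) refl ()

star-isTree : ∀ m → IsTree (star m)
star-isTree m = conn , acyc
  where
  conn : Connected (star m)
  conn zero    zero    = ε
  conn zero    (suc _) = tt ◅ ε
  conn (suc _) zero    = tt ◅ ε
  conn (suc _) (suc _) = _◅_ {j = zero} tt (tt ◅ ε)

  acyc : ¬ Cycle (star m)
  -- If `x` is a leaf, both its neighbours on the cycle are `zero`. If `x` is `zero`, the next
  -- vertex is a leaf, and the one after it is `zero` again. Either way a vertex repeats.
  acyc record { vs = [] ; nonempty = nonempty } = nonempty refl
  acyc record { x = suc _ ; y = zero ; vs = zero ∷ vs ; distinct = _ ∷ (0∉ ∷ _) } =
    All.lookup 0∉ (∈-++⁺ʳ vs (here refl)) refl
  acyc record { x = zero ; vs = suc _ ∷ [] ; y = zero ; distinct = (_ ∷ (0≢0 ∷ _)) ∷ _ } = 0≢0 refl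
  acyc record { x = zero ; vs = suc _ ∷ zero ∷ _ ; distinct = (_ ∷ (0≢0 ∷ _)) ∷ _ } = 0≢0 refl
  acyc record { x = zero ; vs = suc _ ∷ suc _ ∷ _ ; path = _ ∷ (() ∷ _) }
  acyc record { x = zero ; vs = suc _ ∷ [] ; y = suc _ ; path = _ ∷ (() ∷ _) }
  acyc record { x = zero ; vs = zero ∷ _ ; path = () ∷ _ }
  acyc record { x = suc _ ; vs = suc _ ∷ _ ; path = () ∷ _ }
  acyc record { x = suc _ ; y = suc _ ; closing = () }

module StarDecomposition {A B : Set} (G : SimpleGraph (A ⊎ B))
  (as : List A) (bs : List B) (as! : Unique as) (bs! : Unique bs)
  (∈-as : ∀ a → a ∈ as) (∈-bs : ∀ b → b ∈ bs)
  (no-aa : ∀ {a a′} → ¬ SimpleGraph.Adj G (inj₁ a) (inj₁ a′))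
  (no-bb : ∀ {b b′} → ¬ SimpleGraph.Adj G (inj₂ b) (inj₂ b′)) where
  open SimpleGraph G

  star-decomposition : TreeDecomposition G
  star-decomposition = record
    { order = length bs ; tree = star (length bs) ; isTree = star-isTree (length bs)
    ; bag = bag ; bagUnique = bag! ; coversVert = coversVert ; coversEdge = coversEdge
    ; connected = connected }
    where
    nbs : B → List A
    nbs b = filter (λ a → adj? (inj₁ a) (inj₂ b)) as

    bag : Fin (suc (length bs)) → List (A ⊎ B)
    bag zero    = map inj₁ as
    bag (suc i) = inj₂ (lookup bs i) ∷ map inj₁ (nbs (lookup bs i))

    inj₂∉ : ∀ {b} xs → inj₂ b ∉ map inj₁ xs
    inj₂∉ xs b∈ with ∈-map⁻ inj₁ {xs = xs} b∈
    ... | _ , _ , ()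

    bag! : ∀ t → Unique (bag t)
    bag! zero    = Unique.map⁺ Sum.inj₁-injective as!
    bag! (suc i) = All.¬Any⇒All¬ _ (inj₂∉ (nbs (lookup bs i)))
      ∷ Unique.map⁺ Sum.inj₁-injective (Unique.filter⁺ _ as!)

    leaf : B → Fin (suc (length bs))
    leaf b = suc (Any.index (∈-bs b))

    ∈-leaf : ∀ b → inj₂ b ∈ bag (leaf b)
    ∈-leaf b = here (cong inj₂ (lookup-index (∈-bs b)))

    edge-∈-leaf : ∀ {a b} → Adj (inj₁ a) (inj₂ b) → inj₁ a ∈ bag (leaf b)
    edge-∈-leaf {a} {b} ab = there (∈-map⁺ inj₁ (∈-filter⁺ _ (∈-as a)
      (subst (λ b → Adj (inj₁ a) (inj₂ b)) (lookup-index (∈-bs b)) ab)))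

    coversVert : ∀ v → ∃ λ t → v ∈ bag t
    coversVert (inj₁ a) = zero , ∈-map⁺ inj₁ (∈-as a)
    coversVert (inj₂ b) = leaf b , ∈-leaf b

    coversEdge : ∀ {u v} → Adj u v → ∃ λ t → u ∈ bag t × v ∈ bag t
    coversEdge {inj₁ _} {inj₁ _} e = contradiction e no-aa
    coversEdge {inj₁ _} {inj₂ b} e = leaf b , edge-∈-leaf e , ∈-leaf b
    coversEdge {inj₂ b} {inj₁ _} e = leaf b , ∈-leaf b , edge-∈-leaf (symm e)
    coversEdge {inj₂ _} {inj₂ _} e = contradiction e no-bb

    at-leaf : ∀ {b i} → inj₂ b ∈ bag (suc i) → b ≡ lookup bs i
    at-leaf (here eq)           = Sum.inj₂-injective eq
    at-leaf {i = i} (there b∈)  = contradiction b∈ (inj₂∉ (nbs (lookup bs i)))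

    -- Every `inj₁ a` is in the centre bag, so walks can go through `zero`. Each `inj₂ b` is in a
    -- single leaf bag, because `bs` has no repetitions.
    connected : ∀ v → InducedConnected (star (length bs)) (λ t → v ∈ bag t)
    connected (inj₁ a) {s} {t} a∈s a∈t = to-zero s a∈s ◅◅ from-zero t a∈t
      where
      a∈0 : inj₁ a ∈ bag zero
      a∈0 = ∈-map⁺ inj₁ (∈-as a)
      to-zero : ∀ s → inj₁ a ∈ bag s → Star _ s zero
      to-zero zero    _   = ε
      to-zero (suc _) a∈s = (tt , a∈s , a∈0) ◅ ε
      from-zero : ∀ t → inj₁ a ∈ bag t → Star _ zero t
      from-zero zero    _   = ε
      from-zero (suc _) a∈t = (tt , a∈0 , a∈t) ◅ ε
    connected (inj₂ b) {zero}          b∈s _   = contradiction b∈s (inj₂∉ as)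
    connected (inj₂ b) {suc _} {zero}  _   b∈t = contradiction b∈t (inj₂∉ as)
    connected (inj₂ b) {suc i} {suc j} b∈s b∈t
      with lookup-injective bs! (trans (sym (at-leaf b∈s)) (at-leaf b∈t))
    ... | refl = ε

  -- A non-neighbour of `b` in `as` makes up for the extra element `b` of its leaf bag, so the
  -- centre bag is a largest one.
  star-width : (∀ b → ∃ λ a → ¬ Adj (inj₁ a) (inj₂ b)) →
    TreeDecomposition.width star-decomposition ≡ length as ∸ 1
  star-width non-nb = cong (_∸ 1) (begin
    length (map inj₁ as) ⊔ Vector.foldr _⊔_ 0 leaf-size ≡⟨ cong (_⊔ Vector.foldr _⊔_ 0 leaf-size) (length-map inj₁ as) ⟩
    length as ⊔ Vector.foldr _⊔_ 0 leaf-size            ≡⟨ ℕ.m≥n⇒m⊔n≡m (foldr-⊔-≤ leaf-size leaf-size≤) ⟩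
    length as                                           ∎)
    where
    open ≡-Reasoning
    leaf-size : Fin (length bs) → ℕ
    leaf-size i = length (TreeDecomposition.bag star-decomposition (suc i))

    below? : ∀ i → Decidable (λ a → Adj (inj₁ a) (inj₂ (lookup bs i)))
    below? i a = adj? (inj₁ a) (inj₂ (lookup bs i))

    leaf-size≤ : ∀ i → leaf-size i ≤ length as
    leaf-size≤ i = let a , a≁b = non-nb (lookup bs i) in
      ℕ.≤-trans (s≤s (ℕ.≤-reflexive (length-map inj₁ (filter (below? i) as))))
        (filter-notAll (below? i) as (lose (∈-as a) a≁b))

-- Enumerating the subsets of a given size.

≟-subset : ∀ {n k} → DecidableEquality (SubsetOfSize n k)
≟-subset = Product.≡-dec (Vec.≡-dec Bool._≟_) λ p q → yes (ℕ.≡-irrelevant p q)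

size-ext : ∀ {n k} {a b : SubsetOfSize n k} → proj₁ a ≡ proj₁ b → a ≡ b
size-ext {a = a , p} {.a , q} refl = cong (a ,_) (ℕ.≡-irrelevant p q)

out : ∀ {n k} → SubsetOfSize n k → SubsetOfSize (suc n) k
out (a , p) = outside ∷ a , p

into : ∀ {n k} → SubsetOfSize n k → SubsetOfSize (suc n) (suc k)
into (a , p) = inside ∷ a , cong suc p

out-injective : ∀ {n k} {a b : SubsetOfSize n k} → out a ≡ out b → a ≡ b
out-injective = size-ext ∘ Vec.∷-injectiveʳ ∘ cong proj₁

into-injective : ∀ {n k} {a b : SubsetOfSize n k} → into a ≡ into b → a ≡ b
into-injective = size-ext ∘ Vec.∷-injectiveʳ ∘ cong proj₁

into≢out : ∀ {n k} {x} {a : SubsetOfSize n k} {b : SubsetOfSize n (suc k)} → x ≡ into a → x ≢ out b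
into≢out refl ()

-- Pascal's recursion on the first element. Enumerating inside an arbitrary set serves both for the
-- parts of the graph and for neighbourhoods.
subsets : ∀ {n} → Subset n → ∀ k → List (SubsetOfSize n k)
subsets []            zero    = [ [] , refl ]
subsets []            (suc k) = []
subsets (outside ∷ b) k       = map out (subsets b k)
subsets (inside  ∷ b) zero    = map out (subsets b zero)
subsets (inside  ∷ b) (suc k) = map into (subsets b k) ++ map out (subsets b (suc k))

nC0≡1 : ∀ n → n C 0 ≡ 1
nC0≡1 n = trans (nCk≡nC[n∸k] {0} {n} z≤n) (nCn≡1 n)

length-subsets : ∀ {n} (b : Subset n) k → length (subsets b k) ≡ Subset.∣ b ∣ C k
length-subsets []            zero    = refl
length-subsets []            (suc k) = refl
length-subsets (outside ∷ b) k       = trans (length-map out (subsets b k)) (length-subsets b k)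
length-subsets (inside  ∷ b) zero    = trans (length-map out (subsets b zero))
  (trans (length-subsets b zero) (trans (nC0≡1 Subset.∣ b ∣) (sym (nC0≡1 (suc Subset.∣ b ∣)))))
length-subsets (inside  ∷ b) (suc k) = begin
  length (map into (subsets b k) ++ map out (subsets b (suc k)))          ≡⟨ length-++ (map into (subsets b k)) ⟩
  length (map into (subsets b k)) + length (map out (subsets b (suc k)))  ≡⟨ cong₂ _+_ (length-map into (subsets b k)) (length-map out (subsets b (suc k))) ⟩
  length (subsets b k) + length (subsets b (suc k))                       ≡⟨ cong₂ _+_ (length-subsets b k) (length-subsets b (suc k)) ⟩
  Subset.∣ b ∣ C k + Subset.∣ b ∣ C suc k                                 ≡⟨ nCk+nC[k+1]≡[n+1]C[k+1] Subset.∣ b ∣ k ⟩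
  suc Subset.∣ b ∣ C suc k                                                ∎
  where open ≡-Reasoning

subsets! : ∀ {n} (b : Subset n) k → Unique (subsets b k)
subsets! []            zero    = [] ∷ []
subsets! []            (suc k) = []
subsets! (outside ∷ b) k       = Unique.map⁺ out-injective (subsets! b k)
subsets! (inside  ∷ b) zero    = Unique.map⁺ out-injective (subsets! b zero)
subsets! (inside  ∷ b) (suc k) =
  Unique.++⁺ (Unique.map⁺ into-injective (subsets! b k)) (Unique.map⁺ out-injective (subsets! b (suc k)))
    λ (x∈ , x∈′) → into≢out (proj₂ (proj₂ (∈-map⁻ into x∈))) (proj₂ (proj₂ (∈-map⁻ out x∈′)))

subsets-⊆ : ∀ {n} (b : Subset n) k → All (λ a → proj₁ a Subset.⊆ b) (subsets b k)
subsets-⊆ []            zero    = id ∷ []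
subsets-⊆ []            (suc k) = []
subsets-⊆ (outside ∷ b) k       = All.map⁺ (All.map Subset.out⊆ (subsets-⊆ b k))
subsets-⊆ (inside  ∷ b) zero    = All.map⁺ (All.map Subset.out⊆ (subsets-⊆ b zero))
subsets-⊆ (inside  ∷ b) (suc k) = All.++⁺
  (All.map⁺ (All.map Subset.in⊆in (subsets-⊆ b k)))
  (All.map⁺ (All.map Subset.out⊆ (subsets-⊆ b (suc k))))

⊆⇒∈-subsets : ∀ {n k} (b : Subset n) (a : SubsetOfSize n k) → proj₁ a Subset.⊆ b → a ∈ subsets b k
⊆⇒∈-subsets []            ([] , refl)          _   = here refl
⊆⇒∈-subsets (outside ∷ b) (outside ∷ a , p)    a⊆b =
  ∈-map⁺ out (⊆⇒∈-subsets b (a , p) (Subset.drop-∷-⊆ a⊆b))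
⊆⇒∈-subsets (outside ∷ b) (inside ∷ a , p)     a⊆b = contradiction (a⊆b here) λ ()
⊆⇒∈-subsets {k = zero} (inside ∷ b) (outside ∷ a , p) a⊆b =
  ∈-map⁺ out (⊆⇒∈-subsets b (a , p) (Subset.drop-∷-⊆ a⊆b))
⊆⇒∈-subsets {k = suc k} (inside ∷ b) (outside ∷ a , p) a⊆b =
  ∈-++⁺ʳ (map into (subsets b k)) (∈-map⁺ out (⊆⇒∈-subsets b (a , p) (Subset.drop-∷-⊆ a⊆b)))
⊆⇒∈-subsets (inside ∷ b)  (inside ∷ a , refl)  a⊆b =
  ∈-++⁺ˡ (∈-map⁺ into (⊆⇒∈-subsets b (a , refl) (Subset.drop-∷-⊆ a⊆b)))

∁-injective : ∀ {n} {a b : Subset n} → ∁ a ≡ ∁ b → a ≡ b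
∁-injective eq = Subset.⊆-antisym
  (Subset.∁p⊆∁q⇒p⊇q (Subset.⊆-reflexive (sym eq))) (Subset.∁p⊆∁q⇒p⊇q (Subset.⊆-reflexive eq))

⊆-∁-swap : ∀ {n} {p q : Subset n} → p Subset.⊆ ∁ q → q Subset.⊆ ∁ p
⊆-∁-swap p⊆∁q x∈q = Subset.x∉p⇒x∈∁p λ x∈p → Subset.x∈∁p⇒x∉p (p⊆∁q x∈p) x∈q

complement : ∀ {n k} → SubsetOfSize n k → SubsetOfSize n (n ∸ k)
complement {n} (a , ∣a∣≡k) = ∁ a , trans (Subset.∣∁p∣≡n∸∣p∣ a) (cong (n ∸_) ∣a∣≡k)

all-subsets : ∀ n k → List (SubsetOfSize n k)
all-subsets n = subsets (Subset.⊤ {n})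

all-subsets! : ∀ n k → Unique (all-subsets n k)
all-subsets! n = subsets! (Subset.⊤ {n})

∈-all-subsets : ∀ {n k} (a : SubsetOfSize n k) → a ∈ all-subsets n k
∈-all-subsets a = ⊆⇒∈-subsets Subset.⊤ a Subset.⊆⊤

length-all-subsets : ∀ n k → length (all-subsets n k) ≡ n C k
length-all-subsets n k = trans (length-subsets (Subset.⊤ {n}) k) (cong (_C k) (Subset.∣⊤∣≡n n))

-- The bipartite Kneser graph: degrees, edges and both width bounds.

module _ {n k : ℕ} where

  -- The (n-k)-sets containing `a` are the complements of the k-sets disjoint from `a`. So in both
  -- parts the degree counts k-subsets of a set of size n - k.
  neighbours : BKVertex n k → List (BKVertex n k)
  neighbours (inj₁ a) = map (inj₂ ∘ complement) (subsets (∁ (proj₁ a)) k)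
  neighbours (inj₂ b) = map inj₁ (subsets (proj₁ b) k)

  neighbours! : ∀ v → Unique (neighbours v)
  neighbours! (inj₁ a) = Unique.map⁺ (size-ext ∘ ∁-injective ∘ cong proj₁ ∘ Sum.inj₂-injective) (subsets! (∁ (proj₁ a)) k)
  neighbours! (inj₂ b) = Unique.map⁺ Sum.inj₁-injective (subsets! (proj₁ b) k)

  neighbours-adj : ∀ v → All (BKAdj n k v) (neighbours v)
  neighbours-adj (inj₁ (a , _)) = All.map⁺ (All.tabulate λ {c} c∈ {_} →
    ⊆-∁-swap {p = proj₁ c} {q = a} (All.lookup (subsets-⊆ (∁ a) k) c∈))
  neighbours-adj (inj₂ (b , _)) = All.map⁺ (subsets-⊆ b k)

  length-neighbours : ∀ v → length (neighbours v) ≡ (n ∸ k) C k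
  length-neighbours (inj₁ (a , refl)) = trans (length-map _ (subsets (∁ a) k))
    (trans (length-subsets (∁ a) k) (cong (_C k) (Subset.∣∁p∣≡n∸∣p∣ a)))
  length-neighbours (inj₂ (b , ∣b∣)) = trans (length-map _ (subsets b k))
    (trans (length-subsets b k) (cong (_C k) ∣b∣))

  part₁ part₂ : List (BKVertex n k)
  part₁ = map inj₁ (all-subsets n k)
  part₂ = map inj₂ (all-subsets n (n ∸ k))

  ∈-part₁⇒nb⊆ : ∀ {v} → v ∈ part₁ → neighbours v ⊆ part₂
  ∈-part₁⇒nb⊆ v∈ w∈ with ∈-map⁻ inj₁ v∈
  ... | _ , _ , refl with ∈-map⁻ (inj₂ ∘ complement) w∈
  ...   | c , _ , refl = ∈-map⁺ inj₂ (∈-all-subsets (complement c))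

  ∈-part₂⇒nb⊆ : ∀ {v} → v ∈ part₂ → neighbours v ⊆ part₁
  ∈-part₂⇒nb⊆ v∈ w∈ with ∈-map⁻ inj₂ v∈
  ... | _ , _ , refl with ∈-map⁻ inj₁ w∈
  ...   | a , _ , refl = ∈-map⁺ inj₁ (∈-all-subsets a)

  part₁#part₂ : ∀ {v} → v ∈ part₁ → v ∉ part₂
  part₁#part₂ v∈ v∈′ with ∈-map⁻ inj₁ v∈ | ∈-map⁻ inj₂ v∈′
  ... | _ , _ , refl | _ , _ , ()

  ≟-BK : DecidableEquality (BKVertex n k)
  ≟-BK = Sum.≡-dec ≟-subset ≟-subset

  module _ (k≤n : k ≤ n) where

    length-part₁ : length part₁ ≡ n C k
    length-part₁ = trans (length-map inj₁ (all-subsets n k)) (length-all-subsets n k)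

    length-part₂ : length part₂ ≡ n C k
    length-part₂ = trans (length-map inj₂ (all-subsets n (n ∸ k)))
      (trans (length-all-subsets n (n ∸ k)) (sym (nCk≡nC[n∸k] k≤n)))

    BK-confined⇒large : 2 * (n C k) ≤ 3 * ((n ∸ k) C k) → ∀ X {u v} → BKAdj n k u v →
      Confined {G = BK n k} ≟-BK X u v → n C k ≤ length X
    BK-confined⇒large 2N≤3d X {u} {v} = go u v
      where
      large : ∀ a b → Confined {G = BK n k} ≟-BK X (inj₁ a) (inj₂ b) → n C k ≤ length X
      large a b = confined⇒large {G = BK n k} ≟-BK 2N≤3d neighbours neighbours! neighbours-adj
        (ℕ.≤-reflexive ∘ sym ∘ length-neighbours) X
        (Unique.map⁺ Sum.inj₁-injective (all-subsets! n k)) (Unique.map⁺ Sum.inj₂-injective (all-subsets! n (n ∸ k)))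
        part₁#part₂ length-part₁ length-part₂ ∈-part₁⇒nb⊆ ∈-part₂⇒nb⊆
        (∈-map⁺ inj₁ (∈-all-subsets a)) (∈-map⁺ inj₂ (∈-all-subsets b))

      go : ∀ u v → BKAdj n k u v → Confined {G = BK n k} ≟-BK X u v → n C k ≤ length X
      go (inj₁ a) (inj₂ b) _ confined = large a b confined
      go (inj₂ b) (inj₁ a) _ confined = large a b (confined ∘ Sum.swap)

    -- From 0 < 2N ≤ 3d it follows that d > 0, so any vertex has a neighbour.
    BK-edge : 2 * (n C k) ≤ 3 * ((n ∸ k) C k) → 0 < n C k → ∃ λ u → ∃ λ v → BKAdj n k u v
    BK-edge 2N≤3d 0<N =
      let u , _  = member part₁ (subst (0 <_) (sym length-part₁) 0<N)
          v , v∈ = member (neighbours u) (subst (0 <_) (sym (length-neighbours u)) 0<d)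
      in u , v , All.lookup (neighbours-adj u) v∈
      where
      0<d : 0 < (n ∸ k) C k
      0<d = ℕ.*-cancelˡ-< 3 0 _ (ℕ.<-≤-trans (ℕ.*-monoʳ-< 2 0<N) 2N≤3d)

    BK-width≥ : 2 * (n C k) ≤ 3 * ((n ∸ k) C k) →
      (D : TreeDecomposition (BK n k)) → n C k ∸ 1 ≤ TreeDecomposition.width D
    -- If all bags have fewer than N elements then N > 0, which provides the starting edge, and no
    -- bag is large enough to be confining.
    BK-width≥ 2N≤3d D = ℕ.∸-monoˡ-≤ 1 (ℕ.≮⇒≥ λ small →
      let _ , _ , uv = BK-edge 2N≤3d (ℕ.≤-<-trans z≤n small) in
      no-unconfined-decomposition ≟-BK D (λ t xy confined → ℕ.<⇒≱
        (ℕ.≤-<-trans (≤-foldr-⊔ (length ∘ TreeDecomposition.bag D) t) small)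
        (BK-confined⇒large 2N≤3d (TreeDecomposition.bag D t) xy confined)) uv)

    -- The complement of `b` has size n - (n - k) = k; being contained in `b` would make it empty,
    -- against `1 ≤ k`.
    BK-non-neighbour : 1 ≤ k → (b : SubsetOfSize n (n ∸ k)) →
      ∃ λ (a : SubsetOfSize n k) → ¬ proj₁ a Subset.⊆ proj₁ b
    BK-non-neighbour 1≤k (b , ∣b∣) = (∁ b , ∣∁b∣) , λ ∁b⊆b → ℕ.<⇒≢ 1≤k (begin
      0                        ≡⟨ Subset.∣⊥∣≡0 n ⟨
      Subset.∣ Subset.⊥ {n} ∣  ≡⟨ cong Subset.∣_∣ (Subset.⊆-antisym Subset.⊥⊆ λ x∈ →
        contradiction (∁b⊆b x∈) (Subset.x∈∁p⇒x∉p x∈)) ⟩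
      Subset.∣ ∁ b ∣           ≡⟨ ∣∁b∣ ⟩
      k                        ∎)
      where
      open ≡-Reasoning
      ∣∁b∣ : Subset.∣ ∁ b ∣ ≡ k
      ∣∁b∣ = trans (Subset.∣∁p∣≡n∸∣p∣ b) (trans (cong (n ∸_) ∣b∣) (ℕ.m∸[m∸n]≡n k≤n))

theorem1p3 : ∀ (n k : ℕ) → 1 ≤ n → 1 ≤ k → n ≥ 2 * k + 1 →
    3 * ((n ∸ k) C k) ≥ 2 * (n C k) → k ≥ 2 →
    IsTreewidth (BK n k) ((n C k) ∸ 1)
theorem1p3 n k _ 1≤k n≥2k+1 2N≤3d _ =
  (Decomp.star-decomposition , trans (Decomp.star-width (BK-non-neighbour k≤n 1≤k))
    (cong (_∸ 1) (length-all-subsets n k)))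
  , BK-width≥ k≤n 2N≤3d
  where
  -- Adjacency within a part is `⊥` by definition, so `id` proves that each part is independent.
  module Decomp = StarDecomposition (BK n k) (all-subsets n k) (all-subsets n (n ∸ k))
    (all-subsets! n k) (all-subsets! n (n ∸ k)) ∈-all-subsets ∈-all-subsets id id

  k≤n : k ≤ n
  k≤n = ℕ.≤-trans (ℕ.m≤m+n k (k + 0)) (ℕ.≤-trans (ℕ.m≤m+n (2 * k) 1) n≥2k+1)
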